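{- Let $d$ and $p$ be integers with $d>p\ge 2$ and let \[ f_{d,p}(m)=\sum_{j=1}^{p}\binom{j+m-2}{j-1}\binom{d-j+m}{d-j}, \] a polynomial of degree $d-1$ in $m$. Let $\mathbf{V}(f_{d,p})=\{a\in\mathbb{C}: f_{d,p}(a)=0\}$. Then \[ \{ -1,-2,\ldots,-(d-p)\}\subset \mathbf{V}(f_{d,p})\cap\mathbb{R}\subset[-(d-2),0). \]
   Context: For an integer $a\ge 0$, $\binom{a+x}{a}$ denotes the polynomial $\prod_{i=1}^{a}(x+i)/a!$ in $x$; so $\binom{j+m-2}{j-1}=\prod_{i=0}^{j-2}(m+i)/(j-1)!$ and $\binom{d-j+m}{d-j}=\prod_{i=1}^{d-j}(m+i)/(d-j)!$. -}

module Defs where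

open import Algebra.Bundles using (CommutativeMonoid)
import Algebra.Properties.CommutativeSemigroup as CommutativeSemigroupₚ
open import Data.List.Base using (List; []; _∷_; map; foldr; applyUpTo)
open import Data.Nat.Base as ℕ using (ℕ; suc; _∸_; _!)
open import Data.Nat.Properties as ℕₚ using (_!≢0)
open import Data.Integer.Base as ℤ using ()
open import Data.Product.Base using (∃-syntax; _×_; _,_)
open import Data.Rational.Base hiding (_≃_)
open import Data.Rational.Properties
open import Level using (0ℓ)
open import Relation.Binary.PropositionalEquality
  using (_≡_; refl; sym; trans; cong; cong₂; subst)
open import Relation.Unary using (Pred; _⊢_)

open CommutativeSemigroupₚ
  (CommutativeMonoid.commutativeSemigroup +-0-commutativeMonoid)
  using (interchange; x∙yz≈y∙xz)

fromℕ : ℕ → ℚ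
fromℕ n = ℤ.+ n / 1

-- The real numbers, as Cauchy sequences of rationals.  The existential is a
-- Σ-type, so a real carries a modulus of convergence.  Equality on ℝ is the
-- relation _≃ᴿ_ below, not _≡_.

Cauchy : (ℕ → ℚ) → Set
Cauchy x = ∀ ε → 0ℚ < ε →
  ∃[ N ] (∀ m n → N ℕ.≤ m → N ℕ.≤ n → ∣ x m - x n ∣ < ε)

record ℝ : Set where
  constructor mkℝ
  field
    seq    : ℕ → ℚ
    cauchy : Cauchy seq

open ℝ public

infix 4 _≃ᴿ_ _<ᴿ_ _≤ᴿ_

_≃ᴿ_ : ℝ → ℝ → Set
x ≃ᴿ y = ∀ ε → 0ℚ < ε →
  ∃[ N ] (∀ n → N ℕ.≤ n → ∣ seq x n - seq y n ∣ < ε)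

_<ᴿ_ : ℝ → ℝ → Set
x <ᴿ y = ∃[ ε ] (0ℚ < ε × ∃[ N ] (∀ n → N ℕ.≤ n → seq x n + ε ≤ seq y n))

_≤ᴿ_ : ℝ → ℝ → Set
x ≤ᴿ y = ∀ ε → 0ℚ < ε →
  ∃[ N ] (∀ n → N ℕ.≤ n → seq x n ≤ seq y n + ε)

half-pos : ∀ {ε} → 0ℚ < ε → 0ℚ < ½ * ε
half-pos {ε} 0<ε =
  subst (_< ½ * ε) (*-zeroʳ ½) (*-monoʳ-<-pos ½ 0<ε)

halves : ∀ ε → ½ * ε + ½ * ε ≡ ε
halves ε = trans (sym (*-distribʳ-+ ε ½ ½)) (*-identityˡ ε)

cauchy-const : ∀ q → Cauchy (λ _ → q)
cauchy-const q ε 0<ε =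
  0 , λ _ _ _ _ → subst (λ r → ∣ r ∣ < ε) (sym (+-inverseʳ q)) 0<ε

cauchy-neg : ∀ {x} → Cauchy x → Cauchy (λ n → - x n)
cauchy-neg {x} cx ε 0<ε with cx ε 0<ε
... | N , h = N , λ m n N≤m N≤n →
  subst (_< ε) (sym (trans (cong ∣_∣ (lemma (x m) (x n))) (∣-p∣≡∣p∣ (x m - x n))))
    (h m n N≤m N≤n)
  where
  lemma : ∀ a b → - a - - b ≡ - (a - b)
  lemma a b = sym (neg-distrib-+ a (- b))

cauchy-+ : ∀ {x y} → Cauchy x → Cauchy y → Cauchy (λ n → x n + y n)
cauchy-+ {x} {y} cx cy ε 0<ε
  with cx (½ * ε) (half-pos 0<ε) | cy (½ * ε) (half-pos 0<ε)
... | N , h | M , k = N ℕ.⊔ M , λ m n ≤m ≤n → begin-strict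
  ∣ (x m + y m) - (x n + y n) ∣
    ≡⟨ cong ∣_∣ (lemma (x m) (y m) (x n) (y n)) ⟩
  ∣ (x m - x n) + (y m - y n) ∣
    ≤⟨ ∣p+q∣≤∣p∣+∣q∣ (x m - x n) (y m - y n) ⟩
  ∣ x m - x n ∣ + ∣ y m - y n ∣
    <⟨ +-mono-< (h m n (ℕₚ.m⊔n≤o⇒m≤o N M ≤m) (ℕₚ.m⊔n≤o⇒m≤o N M ≤n))
                (k m n (ℕₚ.m⊔n≤o⇒n≤o N M ≤m) (ℕₚ.m⊔n≤o⇒n≤o N M ≤n)) ⟩
  ½ * ε + ½ * ε
    ≡⟨ halves ε ⟩
  ε ∎
  where
  open ≤-Reasoning
  lemma : ∀ a b c d → (a + b) - (c + d) ≡ (a - c) + (b - d)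
  lemma a b c d = begin-equality
    (a + b) - (c + d)          ≡⟨ cong (a + b +_) (neg-distrib-+ c d) ⟩
    (a + b) + (- c + - d)      ≡⟨ interchange a b (- c) (- d) ⟩
    (a - c) + (b - d)          ∎

bounded : ∀ {x} → Cauchy x →
  ∃[ K ] (0ℚ < K × ∃[ N ] (∀ n → N ℕ.≤ n → ∣ x n ∣ ≤ K))
bounded {x} cx with cx 1ℚ (positive⁻¹ 1ℚ)
... | N , h =
    ∣ x N ∣ + 1ℚ
  , +-mono-≤-< (0≤∣p∣ (x N)) (positive⁻¹ 1ℚ)
  , N , λ n N≤n → begin
    ∣ x n ∣                   ≡⟨ cong ∣_∣ (lemma (x n) (x N)) ⟩
    ∣ x N + (x n - x N) ∣     ≤⟨ ∣p+q∣≤∣p∣+∣q∣ (x N) (x n - x N) ⟩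
    ∣ x N ∣ + ∣ x n - x N ∣   ≤⟨ +-monoʳ-≤ ∣ x N ∣ (<⇒≤ (h n N N≤n ℕₚ.≤-refl)) ⟩
    ∣ x N ∣ + 1ℚ              ∎
  where
  open ≤-Reasoning
  lemma : ∀ a b → a ≡ b + (a - b)
  lemma a b = begin-equality
    a              ≡⟨ +-identityʳ a ⟨
    a + 0ℚ         ≡⟨ cong (a +_) (+-inverseʳ b) ⟨
    a + (b - b)    ≡⟨ x∙yz≈y∙xz a b (- b) ⟩
    b + (a - b)    ∎

shrink : ∀ {K ε} → 0ℚ < K → 0ℚ < ε → ∃[ δ ] (0ℚ < δ × K * δ ≡ ε)
shrink {K} {ε} 0<K 0<ε = 1/ K * ε , 0<δ , eq
  where
  instance
    K-pos : Positive K
    K-pos = positive 0<K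
    K≢0 : NonZero K
    K≢0 = pos⇒nonZero K
    1/K-pos : Positive (1/ K)
    1/K-pos = 1/pos⇒pos K
  0<δ : 0ℚ < 1/ K * ε
  0<δ = subst (_< 1/ K * ε) (*-zeroʳ (1/ K)) (*-monoʳ-<-pos (1/ K) 0<ε)
  eq : K * (1/ K * ε) ≡ ε
  eq = trans (sym (*-assoc K (1/ K) ε))
             (trans (cong (_* ε) (*-inverseʳ K)) (*-identityˡ ε))

scaled : ∀ {K δ η} a b → 0ℚ < K → ∣ a ∣ ≤ K → ∣ b ∣ < δ → K * δ ≡ η →
         ∣ a * b ∣ < η
scaled {K} {δ} {η} a b 0<K a≤K b<δ eq = begin-strict
  ∣ a * b ∣      ≡⟨ ∣p*q∣≡∣p∣*∣q∣ a b ⟩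
  ∣ a ∣ * ∣ b ∣  ≤⟨ *-monoʳ-≤-nonNeg ∣ b ∣ {{nonNegative (0≤∣p∣ b)}} a≤K ⟩
  K * ∣ b ∣      <⟨ *-monoʳ-<-pos K {{positive 0<K}} b<δ ⟩
  K * δ          ≡⟨ eq ⟩
  η              ∎
  where open ≤-Reasoning

cauchy-* : ∀ {x y} → Cauchy x → Cauchy y → Cauchy (λ n → x n * y n)
cauchy-* {x} {y} cx cy ε 0<ε with bounded cx | bounded cy
... | K , 0<K , A , bx | L , 0<L , B , by
  with shrink 0<K (half-pos 0<ε) | shrink 0<L (half-pos 0<ε)
... | δ , 0<δ , Kδ | γ , 0<γ , Lγ
  with cy δ 0<δ | cx γ 0<γ
... | N , h | M , k = (A ℕ.⊔ B) ℕ.⊔ (N ℕ.⊔ M) , λ m n ≤m ≤n → begin-strict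
  ∣ x m * y m - x n * y n ∣
    ≡⟨ cong ∣_∣ (lemma (x m) (y m) (x n) (y n)) ⟩
  ∣ x m * (y m - y n) + y n * (x m - x n) ∣
    ≤⟨ ∣p+q∣≤∣p∣+∣q∣ (x m * (y m - y n)) (y n * (x m - x n)) ⟩
  ∣ x m * (y m - y n) ∣ + ∣ y n * (x m - x n) ∣
    <⟨ +-mono-<
         (scaled (x m) (y m - y n) 0<K (bx m (toA ≤m)) (h m n (toN ≤m) (toN ≤n)) Kδ)
         (scaled (y n) (x m - x n) 0<L (by n (toB ≤n)) (k m n (toM ≤m) (toM ≤n)) Lγ) ⟩
  ½ * ε + ½ * ε
    ≡⟨ halves ε ⟩
  ε ∎
  where
  open ≤-Reasoning
  *-distribˡ-- : ∀ a b c → a * (b - c) ≡ a * b - a * c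
  *-distribˡ-- a b c = trans (*-distribˡ-+ a b (- c))
    (cong (a * b +_) (sym (neg-distribʳ-* a c)))
  telescope : ∀ u v w → u - w ≡ (u - v) + (v - w)
  telescope u v w = begin-equality
    u - w                  ≡⟨ cong (_- w) (+-identityʳ u) ⟨
    u + 0ℚ - w             ≡⟨ cong (λ r → u + r - w) (+-inverseˡ v) ⟨
    u + (- v + v) - w      ≡⟨ cong (_- w) (+-assoc u (- v) v) ⟨
    (u - v) + v - w        ≡⟨ +-assoc (u - v) v (- w) ⟩
    (u - v) + (v - w)      ∎
  lemma : ∀ a b c d → a * b - c * d ≡ a * (b - d) + d * (a - c)
  lemma a b c d = begin-equality
    a * b - c * d
      ≡⟨ telescope (a * b) (a * d) (c * d) ⟩
    (a * b - a * d) + (a * d - c * d)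
      ≡⟨ cong₂ (λ u v → (a * b - a * d) + (u - v)) (*-comm a d) (*-comm c d) ⟩
    (a * b - a * d) + (d * a - d * c)
      ≡⟨ cong₂ _+_ (*-distribˡ-- a b d) (*-distribˡ-- d a c) ⟨
    a * (b - d) + d * (a - c) ∎
  toAB : ∀ {i} → (A ℕ.⊔ B) ℕ.⊔ (N ℕ.⊔ M) ℕ.≤ i → A ℕ.⊔ B ℕ.≤ i
  toAB = ℕₚ.m⊔n≤o⇒m≤o (A ℕ.⊔ B) (N ℕ.⊔ M)
  toNM : ∀ {i} → (A ℕ.⊔ B) ℕ.⊔ (N ℕ.⊔ M) ℕ.≤ i → N ℕ.⊔ M ℕ.≤ i
  toNM = ℕₚ.m⊔n≤o⇒n≤o (A ℕ.⊔ B) (N ℕ.⊔ M)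
  toA : ∀ {i} → (A ℕ.⊔ B) ℕ.⊔ (N ℕ.⊔ M) ℕ.≤ i → A ℕ.≤ i
  toA ≤i = ℕₚ.m⊔n≤o⇒m≤o A B (toAB ≤i)
  toB : ∀ {i} → (A ℕ.⊔ B) ℕ.⊔ (N ℕ.⊔ M) ℕ.≤ i → B ℕ.≤ i
  toB ≤i = ℕₚ.m⊔n≤o⇒n≤o A B (toAB ≤i)
  toN : ∀ {i} → (A ℕ.⊔ B) ℕ.⊔ (N ℕ.⊔ M) ℕ.≤ i → N ℕ.≤ i
  toN ≤i = ℕₚ.m⊔n≤o⇒m≤o N M (toNM ≤i)
  toM : ∀ {i} → (A ℕ.⊔ B) ℕ.⊔ (N ℕ.⊔ M) ℕ.≤ i → M ℕ.≤ i
  toM ≤i = ℕₚ.m⊔n≤o⇒n≤o N M (toNM ≤i)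

infix  8 -ᴿ_
infixl 7 _*ᴿ_
infixl 6 _+ᴿ_ _-ᴿ_

fromℚ : ℚ → ℝ
fromℚ q = mkℝ (λ _ → q) (cauchy-const q)

0ᴿ : ℝ
0ᴿ = fromℚ 0ℚ

_+ᴿ_ : ℝ → ℝ → ℝ
x +ᴿ y = mkℝ (λ n → seq x n + seq y n) (cauchy-+ {seq x} {seq y} (cauchy x) (cauchy y))

-ᴿ_ : ℝ → ℝ
-ᴿ x = mkℝ (λ n → - seq x n) (cauchy-neg {seq x} (cauchy x))

_-ᴿ_ : ℝ → ℝ → ℝ
x -ᴿ y = x +ᴿ -ᴿ y

_*ᴿ_ : ℝ → ℝ → ℝ
x *ᴿ y = mkℝ (λ n → seq x n * seq y n) (cauchy-* {seq x} {seq y} (cauchy x) (cauchy y))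

record ℂ : Set where
  constructor _+i_
  field
    re : ℝ
    im : ℝ

open ℂ public

infix  4 _≃ᶜ_
infixl 7 _*ᶜ_
infixl 6 _+ᶜ_

_≃ᶜ_ : ℂ → ℂ → Set
z ≃ᶜ w = re z ≃ᴿ re w × im z ≃ᴿ im w

fromℝ : ℝ → ℂ
fromℝ x = x +i 0ᴿ

0ᶜ : ℂ
0ᶜ = fromℝ 0ᴿ

_+ᶜ_ : ℂ → ℂ → ℂ
z +ᶜ w = (re z +ᴿ re w) +i (im z +ᴿ im w)

_*ᶜ_ : ℂ → ℂ → ℂ
z *ᶜ w = (re z *ᴿ re w -ᴿ im z *ᴿ im w) +i (re z *ᴿ im w +ᴿ im z *ᴿ re w)

-- Polynomials in one variable over ℚ: the list of coefficients, constant term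
-- first (trailing zeros allowed).

Poly : Set
Poly = List ℚ

infixl 7 _*ᴾ_ _·ᴾ_
infixl 6 _+ᴾ_

constᴾ : ℚ → Poly
constᴾ c = c ∷ []

X : Poly
X = 0ℚ ∷ 1ℚ ∷ []

_+ᴾ_ : Poly → Poly → Poly
[]      +ᴾ q       = q
(a ∷ p) +ᴾ []      = a ∷ p
(a ∷ p) +ᴾ (b ∷ q) = (a + b) ∷ (p +ᴾ q)

_·ᴾ_ : ℚ → Poly → Poly
c ·ᴾ p = map (c *_) p

_*ᴾ_ : Poly → Poly → Poly
[]      *ᴾ q = []
(a ∷ p) *ᴾ q = (a ·ᴾ q) +ᴾ (0ℚ ∷ (p *ᴾ q))

sumᴾ : List Poly → Poly
sumᴾ = foldr _+ᴾ_ []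

productᴾ : List Poly → Poly
productᴾ = foldr _*ᴾ_ (constᴾ 1ℚ)

eval : Poly → ℂ → ℂ
eval []      z = 0ᶜ
eval (c ∷ p) z = fromℝ (fromℚ c) +ᶜ z *ᶜ eval p z

-- binom a s is the polynomial (a + s choose a) = ∏_{i=1}^{a} (s + i) / a!,
-- with a polynomial s substituted for the variable.

binom : ℕ → Poly → Poly
binom a s =
  (_/_ (ℤ.+ 1) (a !) {{a !≢0}}) ·ᴾ
  productᴾ (applyUpTo (λ i → s +ᴾ constᴾ (fromℕ (suc i))) a)

-- The j-th summand of f d p.  Its first factor is (j + m - 2 choose j - 1),
-- that is, (a + s choose a) with a = j - 1 and s = m - 1.

term : ℕ → ℕ → Poly
term d j = binom (j ∸ 1) (X +ᴾ constᴾ (- 1ℚ)) *ᴾ binom (d ∸ j) X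

f : ℕ → ℕ → Poly
f d p = sumᴾ (applyUpTo (λ i → term d (suc i)) p)

V : Poly → Pred ℂ 0ℓ
V g z = eval g z ≃ᶜ 0ᶜ

infix 9 _∩ℝ

_∩ℝ : Pred ℂ 0ℓ → Pred ℝ 0ℓ
S ∩ℝ = fromℝ ⊢ S

-- The set {-1, -2, …, -n}.

negatives : ℕ → Pred ℝ 0ℓ
negatives n x = ∃[ k ] (1 ℕ.≤ k × k ℕ.≤ n × x ≃ᴿ -ᴿ fromℚ (fromℕ k))

[_,_⟩ : ℝ → ℝ → Pred ℝ 0ℓ
[ a , b ⟩ x = a ≤ᴿ x × x <ᴿ b

{-# OPTIONS --safe #-}
module Submission where

-- Write q for the variable.  At q = -k with 1 ≤ k ≤ d - p the second factor of
-- every summand vanishes.  For q ≥ 0 every summand is nonnegative and the first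
-- is bounded below by a positive constant.  For q ≤ -(d - 2) - ε the summands
-- with j ≥ 2 have the sign (-1)^(d-1), being products of d - 1 negative factors;
-- the summand j = 1 may have the wrong sign, but added to the summand j = 2 it
-- gives, with n = d - 2 and B = (q + n choose n),
--   B (q + 1 + q / (n + 1)),
-- which has the sign (-1)^(d-1) and is bounded away from 0.  Real zeros follow
-- from these rational estimates because a polynomial of a Cauchy sequence tends
-- to 0 exactly when the real it represents is a zero.

open import Defs
open import Data.Nat.Base using (ℕ; _∸_; _≤_; _<_)
open import Data.Product.Base using (_×_)
open import Relation.Unary using (_⊆_)

open import Algebra.Bundles using (CommutativeRing)
import Data.Integer.Base as ℤ
import Data.Integer.Properties as ℤ
open import Data.List.Base using ([]; _∷_; _∷ʳ_; applyUpTo; length)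
open import Data.List.Properties using (applyUpTo-∷ʳ; length-applyUpTo)
open import Data.List.Relation.Unary.All using (All; []; _∷_)
import Data.List.Relation.Unary.All.Properties as All
open import Data.List.Relation.Unary.Any using (Any; here; there)
import Data.List.Relation.Unary.Any.Properties as Any
open import Data.Nat.Base as ℕ using (zero; suc; s≤s; z≤n; _!)
import Data.Nat.Properties as ℕ
open import Data.Product.Base using (_,_; ∃-syntax)
open import Data.Sum.Base using (inj₁; inj₂)
open import Data.Rational.Base as ℚ
  using (ℚ; 0ℚ; 1ℚ; ½; _+_; _*_; _-_; -_; _/_; ∣_∣; toℚᵘ)
import Data.Rational.Properties as ℚ
open import Data.Rational.Solver using (module +-*-Solver)
import Data.Rational.Unnormalised.Base as ℚᵘ
import Data.Rational.Unnormalised.Properties as ℚᵘ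
open import Relation.Binary.PropositionalEquality
  using (_≡_; refl; sym; trans; cong; cong₂; subst; subst₂)
open import Relation.Nullary using (yes; no)

open import Algebra.Properties.Semiring.Exp
  (CommutativeRing.semiring ℚ.+-*-commutativeRing) using (_^_; ^-homo-*)

open +-*-Solver using (solve; _:+_; _:*_; :-_; _:=_; con)

-- Signs, powers and absolute values of rationals.

0≤* : ∀ {a b} → 0ℚ ℚ.≤ a → 0ℚ ℚ.≤ b → 0ℚ ℚ.≤ a * b
0≤* {a} {b} 0≤a 0≤b = subst (ℚ._≤ a * b) (ℚ.*-zeroʳ a)
  (ℚ.*-monoˡ-≤-nonNeg a {{ℚ.nonNegative 0≤a}} 0≤b)

0<* : ∀ {a b} → 0ℚ ℚ.< a → 0ℚ ℚ.< b → 0ℚ ℚ.< a * b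
0<* {a} {b} 0<a 0<b = subst (ℚ._< a * b) (ℚ.*-zeroʳ a)
  (ℚ.*-monoʳ-<-pos a {{ℚ.positive 0<a}} 0<b)

*-mono-≤-nonNeg : ∀ {a b c d} → 0ℚ ℚ.≤ a → 0ℚ ℚ.≤ c →
                  a ℚ.≤ b → c ℚ.≤ d → a * c ℚ.≤ b * d
*-mono-≤-nonNeg {a} {b} {c} {d} 0≤a 0≤c a≤b c≤d = ℚ.≤-trans
  (ℚ.*-monoˡ-≤-nonNeg a {{ℚ.nonNegative 0≤a}} c≤d)
  (ℚ.*-monoʳ-≤-nonNeg d {{ℚ.nonNegative (ℚ.≤-trans 0≤c c≤d)}} a≤b)

p≤∣p∣ : ∀ p → p ℚ.≤ ∣ p ∣
p≤∣p∣ p with ℚ.≤-total 0ℚ p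
... | inj₁ 0≤p = ℚ.≤-reflexive (sym (ℚ.0≤p⇒∣p∣≡p 0≤p))
... | inj₂ p≤0 = ℚ.≤-trans p≤0 (ℚ.0≤∣p∣ p)

0<^ : ∀ {a} n → 0ℚ ℚ.< a → 0ℚ ℚ.< a ^ n
0<^ zero    0<a = ℚ.positive⁻¹ 1ℚ
0<^ (suc n) 0<a = 0<* 0<a (0<^ n 0<a)

0≤^ : ∀ {a} n → 0ℚ ℚ.≤ a → 0ℚ ℚ.≤ a ^ n
0≤^ zero    0≤a = ℚ.nonNegative⁻¹ 1ℚ
0≤^ (suc n) 0≤a = 0≤* 0≤a (0≤^ n 0≤a)

∣^∣≡1 : ∀ {c} n → ∣ c ∣ ≡ 1ℚ → ∣ c ^ n ∣ ≡ 1ℚ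
∣^∣≡1     zero    ∣c∣≡1 = refl
∣^∣≡1 {c} (suc n) ∣c∣≡1 =
  trans (ℚ.∣p*q∣≡∣p∣*∣q∣ c (c ^ n)) (cong₂ _*_ ∣c∣≡1 (∣^∣≡1 n ∣c∣≡1))

-- Here c will be a power of 1 or of - 1 that makes r positive; the lemma drops the sign at the end
-- of an estimate.
≤-*-unit⇒≤-∣∣ : ∀ {δ} c r → ∣ c ∣ ≡ 1ℚ → δ ℚ.≤ c * r → δ ℚ.≤ ∣ r ∣
≤-*-unit⇒≤-∣∣ {δ} c r ∣c∣≡1 δ≤ = begin
  δ              ≤⟨ δ≤ ⟩
  c * r          ≤⟨ p≤∣p∣ (c * r) ⟩
  ∣ c * r ∣      ≡⟨ ℚ.∣p*q∣≡∣p∣*∣q∣ c r ⟩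
  ∣ c ∣ * ∣ r ∣  ≡⟨ cong (_* ∣ r ∣) ∣c∣≡1 ⟩
  1ℚ * ∣ r ∣     ≡⟨ ℚ.*-identityˡ ∣ r ∣ ⟩
  ∣ r ∣          ∎
  where open ℚ.≤-Reasoning

-- Natural numbers and reciprocals of factorials in ℚ.

fromℕ≃ : ∀ n → toℚᵘ (fromℕ n) ℚᵘ.≃ ℚᵘ.mkℚᵘ (ℤ.+ n) 0
fromℕ≃ n = ℚ.toℚᵘ-fromℚᵘ (ℚᵘ.mkℚᵘ (ℤ.+ n) 0)

fromℕ-mono-≤ : ∀ {m n} → m ≤ n → fromℕ m ℚ.≤ fromℕ n
fromℕ-mono-≤ {m} {n} m≤n = ℚ.toℚᵘ-cancel-≤
  (ℚᵘ.≤-respʳ-≃ (ℚᵘ.≃-sym (fromℕ≃ n)) (ℚᵘ.≤-respˡ-≃ (ℚᵘ.≃-sym (fromℕ≃ m))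
    (ℚᵘ.*≤* (ℤ.*-monoʳ-≤-nonNeg (ℤ.+ 1) (ℤ.+≤+ m≤n)))))

fromℕ-suc : ∀ n → fromℕ (suc n) ≡ fromℕ n + 1ℚ
fromℕ-suc n = ℚ.toℚᵘ-injective (begin
  toℚᵘ (fromℕ (suc n))                        ≈⟨ fromℕ≃ (suc n) ⟩
  ℚᵘ.mkℚᵘ (ℤ.+ suc n) 0                       ≡⟨ cong (λ i → ℚᵘ.mkℚᵘ i 0) eq ⟩
  ℚᵘ.mkℚᵘ (ℤ.+ n) 0 ℚᵘ.+ ℚᵘ.mkℚᵘ (ℤ.+ 1) 0    ≈⟨ ℚᵘ.+-congˡ (ℚᵘ.mkℚᵘ (ℤ.+ 1) 0) (fromℕ≃ n) ⟨
  toℚᵘ (fromℕ n) ℚᵘ.+ toℚᵘ 1ℚ                 ≈⟨ ℚ.toℚᵘ-homo-+ (fromℕ n) 1ℚ ⟨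
  toℚᵘ (fromℕ n + 1ℚ)                         ∎)
  where
  open ℚᵘ.≃-Reasoning
  eq : ℤ.+ suc n ≡ ℤ.+ n ℤ.* ℤ.+ 1 ℤ.+ ℤ.+ 1
  eq = trans (cong ℤ.+_ (ℕ.+-comm 1 n)) (cong (ℤ._+ ℤ.+ 1) (sym (ℤ.*-identityʳ (ℤ.+ n))))

fromℕ-* : ∀ m n → fromℕ (m ℕ.* n) ≡ fromℕ m * fromℕ n
fromℕ-* m n = ℚ.toℚᵘ-injective (begin
  toℚᵘ (fromℕ (m ℕ.* n))                      ≈⟨ fromℕ≃ (m ℕ.* n) ⟩
  ℚᵘ.mkℚᵘ (ℤ.+ (m ℕ.* n)) 0                   ≡⟨ cong (λ i → ℚᵘ.mkℚᵘ i 0) (ℤ.pos-* m n) ⟩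
  ℚᵘ.mkℚᵘ (ℤ.+ m) 0 ℚᵘ.* ℚᵘ.mkℚᵘ (ℤ.+ n) 0    ≈⟨ ℚᵘ.*-cong (fromℕ≃ m) (fromℕ≃ n) ⟨
  toℚᵘ (fromℕ m) ℚᵘ.* toℚᵘ (fromℕ n)          ≈⟨ ℚ.toℚᵘ-homo-* (fromℕ m) (fromℕ n) ⟨
  toℚᵘ (fromℕ m * fromℕ n)                    ∎)
  where open ℚᵘ.≃-Reasoning

1/n*n≡1 : ∀ n .{{_ : ℕ.NonZero n}} → (ℤ.+ 1 / n) * fromℕ n ≡ 1ℚ
1/n*n≡1 (suc n) = ℚ.toℚᵘ-injective (begin
  toℚᵘ ((ℤ.+ 1 / suc n) * fromℕ (suc n))           ≈⟨ ℚ.toℚᵘ-homo-* (ℤ.+ 1 / suc n) (fromℕ (suc n)) ⟩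
  toℚᵘ (ℤ.+ 1 / suc n) ℚᵘ.* toℚᵘ (fromℕ (suc n))   ≈⟨ ℚᵘ.*-cong (ℚ.toℚᵘ-fromℚᵘ (ℚᵘ.mkℚᵘ (ℤ.+ 1) n)) (fromℕ≃ (suc n)) ⟩
  ℚᵘ.mkℚᵘ (ℤ.+ 1) n ℚᵘ.* ℚᵘ.mkℚᵘ (ℤ.+ suc n) 0     ≈⟨ ℚᵘ.*-inverseˡ (ℚᵘ.mkℚᵘ (ℤ.+ suc n) 0) ⟩
  ℚᵘ.1ℚᵘ                                           ∎)
  where open ℚᵘ.≃-Reasoning

-- Multiplying by 1 = (1/m · m)(1/n · n) and regrouping avoids any comparison of reduced fractions.
1/[m*n] : ∀ m n .{{_ : ℕ.NonZero m}} .{{_ : ℕ.NonZero n}} .{{_ : ℕ.NonZero (m ℕ.* n)}} →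
          ℤ.+ 1 / (m ℕ.* n) ≡ (ℤ.+ 1 / m) * (ℤ.+ 1 / n)
1/[m*n] m n = begin-equality
  u                             ≡⟨ ℚ.*-identityʳ u ⟨
  u * (1ℚ * 1ℚ)                 ≡⟨ cong₂ (λ x y → u * (x * y)) (1/n*n≡1 m) (1/n*n≡1 n) ⟨
  u * ((v * M) * (w * N))       ≡⟨ solve 5 (λ u v w M N →
                                     u :* ((v :* M) :* (w :* N)) := (u :* (M :* N)) :* (v :* w))
                                     refl u v w M N ⟩
  (u * (M * N)) * (v * w)       ≡⟨ cong (λ x → (u * x) * (v * w)) (fromℕ-* m n) ⟨
  (u * fromℕ (m ℕ.* n)) * (v * w) ≡⟨ cong (_* (v * w)) (1/n*n≡1 (m ℕ.* n)) ⟩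
  1ℚ * (v * w)                  ≡⟨ ℚ.*-identityˡ (v * w) ⟩
  v * w                         ∎
  where
  open ℚ.≤-Reasoning
  u = ℤ.+ 1 / (m ℕ.* n)
  v = ℤ.+ 1 / m
  w = ℤ.+ 1 / n
  M = fromℕ m
  N = fromℕ n

1/!_ : ℕ → ℚ
1/! n = _/_ (ℤ.+ 1) (n !) {{n ℕ.!≢0}}

1/n-pos : ∀ n .{{_ : ℕ.NonZero n}} → 0ℚ ℚ.< ℤ.+ 1 / n
1/n-pos n = ℚ.positive⁻¹ (ℤ.+ 1 / n) {{ℚ.normalize-pos 1 n}}

1/!-pos : ∀ n → 0ℚ ℚ.< 1/! n
1/!-pos n = 1/n-pos (n !) {{n ℕ.!≢0}}

1/!-suc : ∀ n → 1/! (suc n) ≡ (ℤ.+ 1 / suc n) * 1/! n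
1/!-suc n = 1/[m*n] (suc n) (n !) {{_}} {{n ℕ.!≢0}} {{suc n ℕ.!≢0}}

-- Evaluation at rational and at real arguments.

evalℚ : Poly → ℚ → ℚ
evalℚ []      q = 0ℚ
evalℚ (c ∷ p) q = c + q * evalℚ p q

eval-fromℝ-im : ∀ p x n → seq (im (eval p (fromℝ x))) n ≡ 0ℚ
eval-fromℝ-im []      x n = refl
eval-fromℝ-im (c ∷ p) x n rewrite eval-fromℝ-im p x n =
  solve 2 (λ a b → con 0ℚ :+ (a :* con 0ℚ :+ con 0ℚ :* b) := con 0ℚ) refl
    (seq x n) (seq (re (eval p (fromℝ x))) n)

-- Real arithmetic acts term by term on sequences, so the agreement is exact at every index and
-- questions about real zeros become questions about rational values.
eval-fromℝ-re : ∀ p x n → seq (re (eval p (fromℝ x))) n ≡ evalℚ p (seq x n)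
eval-fromℝ-re []      x n = refl
eval-fromℝ-re (c ∷ p) x n rewrite eval-fromℝ-re p x n =
  solve 3 (λ c a b → c :+ (a :+ :- (con 0ℚ :* b)) := c :+ a) refl
    c (seq x n * evalℚ p (seq x n)) (seq (im (eval p (fromℝ x))) n)

-- This sequence is the real part of a complex value already constructed, and inherits its modulus.
cauchy-evalℚ : ∀ p x → Cauchy (λ n → evalℚ p (seq x n))
cauchy-evalℚ p x ε 0<ε with cauchy (re (eval p (fromℝ x))) ε 0<ε
... | N , h = N , λ m n N≤m N≤n →
  subst₂ (λ a b → ∣ a - b ∣ ℚ.< ε) (eval-fromℝ-re p x m) (eval-fromℝ-re p x n) (h m n N≤m N≤n)

Null : (ℕ → ℚ) → Set
Null s = ∀ ε → 0ℚ ℚ.< ε → ∃[ N ] (∀ n → N ≤ n → ∣ s n ∣ ℚ.< ε)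

minus-0 : ∀ q → q - 0ℚ ≡ q
minus-0 = ℚ.+-identityʳ

V⇒Null : ∀ {g x} → V g (fromℝ x) → Null (λ n → evalℚ g (seq x n))
V⇒Null {g} {x} (hre , _) ε 0<ε with hre ε 0<ε
... | N , h = N , λ n N≤n →
  subst (λ a → ∣ a ∣ ℚ.< ε) (trans (minus-0 _) (eval-fromℝ-re g x n)) (h n N≤n)

Null⇒V : ∀ {g x} → Null (λ n → evalℚ g (seq x n)) → V g (fromℝ x)
Null⇒V {g} {x} null =
    (λ ε 0<ε → let N , h = null ε 0<ε in N , λ n N≤n →
      subst (λ a → ∣ a ∣ ℚ.< ε) (sym (trans (minus-0 _) (eval-fromℝ-re g x n))) (h n N≤n))
  , (λ ε 0<ε → 0 , λ n _ →
      subst (λ a → ∣ a ∣ ℚ.< ε) (sym (trans (minus-0 _) (eval-fromℝ-im g x n))) 0<ε)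

-- Synthetic division by X - a.
quotient : Poly → ℚ → Poly
quotient []      a = []
quotient (c ∷ p) a = evalℚ p a ∷ quotient p a

-- The remainder theorem: by Horner's rule the coefficients of the quotient are the values at a of
-- the successive tails of p.
evalℚ-quotient : ∀ p a q → evalℚ p q ≡ evalℚ p a + evalℚ (quotient p a) q * (q - a)
evalℚ-quotient []      a q = solve 2 (λ a q → con 0ℚ := con 0ℚ :+ con 0ℚ :* (q :+ :- a)) refl a q
evalℚ-quotient (c ∷ p) a q rewrite evalℚ-quotient p a q =
  solve 5 (λ c q a v h →
      c :+ q :* (v :+ h :* (q :+ :- a)) :=
      (c :+ a :* v) :+ (v :+ q :* h) :* (q :+ :- a)) refl
    c q a (evalℚ p a) (evalℚ (quotient p a) q)

-- Continuity at a along the sequence of x: the difference of values is the quotient times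
-- `seq x n - a`, and the quotient is bounded by some K from an index N on, so δ = ε / K works.
evalℚ-near : ∀ g x a ε → 0ℚ ℚ.< ε →
  ∃[ δ ] (0ℚ ℚ.< δ × ∃[ N ] (∀ n → N ≤ n → ∣ seq x n - a ∣ ℚ.< δ →
    ∣ evalℚ g (seq x n) - evalℚ g a ∣ ℚ.< ε))
evalℚ-near g x a ε 0<ε =
  let K , 0<K , N , bound = bounded {λ n → evalℚ (quotient g a) (seq x n)}
                              (cauchy-evalℚ (quotient g a) x)
      δ , 0<δ , Kδ≡ε = shrink 0<K 0<ε
  in δ , 0<δ , N , λ n N≤n close →
    subst (λ r → ∣ r ∣ ℚ.< ε) (sym (diff (seq x n)))
      (scaled (evalℚ (quotient g a) (seq x n)) (seq x n - a) 0<K (bound n N≤n) close Kδ≡ε)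
  where
  diff : ∀ q → evalℚ g q - evalℚ g a ≡ evalℚ (quotient g a) q * (q - a)
  diff q = trans (cong (_- evalℚ g a) (evalℚ-quotient g a q))
    (solve 2 (λ v h → (v :+ h) :+ :- v := h) refl (evalℚ g a) (evalℚ (quotient g a) q * (q - a)))

-- Continuity at a, where the value is 0, makes the values along x tend to 0.
root⇒V : ∀ {g a x} → evalℚ g a ≡ 0ℚ → x ≃ᴿ fromℚ a → V g (fromℝ x)
root⇒V {g} {a} {x} ga≡0 x≃a = Null⇒V {g} {x} λ ε 0<ε →
  let δ , 0<δ , N , near = evalℚ-near g x a ε 0<ε
      M , close = x≃a δ 0<δ
  in N ℕ.⊔ M , λ n ≤n →
    subst (λ r → ∣ r ∣ ℚ.< ε)
      (trans (cong (λ r → evalℚ g (seq x n) - r) ga≡0) (minus-0 _))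
      (near n (ℕ.m⊔n≤o⇒m≤o N M ≤n) (close n (ℕ.m⊔n≤o⇒n≤o N M ≤n)))

-- Evaluation of sums and products of polynomials.

evalℚ-+ : ∀ p r q → evalℚ (p +ᴾ r) q ≡ evalℚ p q + evalℚ r q
evalℚ-+ []      r       q = sym (ℚ.+-identityˡ (evalℚ r q))
evalℚ-+ (a ∷ p) []      q = sym (ℚ.+-identityʳ (evalℚ (a ∷ p) q))
evalℚ-+ (a ∷ p) (b ∷ r) q rewrite evalℚ-+ p r q =
  solve 5 (λ a b q u v → (a :+ b) :+ q :* (u :+ v) := (a :+ q :* u) :+ (b :+ q :* v)) refl
    a b q (evalℚ p q) (evalℚ r q)

evalℚ-· : ∀ c p q → evalℚ (c ·ᴾ p) q ≡ c * evalℚ p q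
evalℚ-· c []      q = sym (ℚ.*-zeroʳ c)
evalℚ-· c (a ∷ p) q rewrite evalℚ-· c p q =
  solve 4 (λ c a q u → c :* a :+ q :* (c :* u) := c :* (a :+ q :* u)) refl c a q (evalℚ p q)

evalℚ-* : ∀ p r q → evalℚ (p *ᴾ r) q ≡ evalℚ p q * evalℚ r q
evalℚ-* []      r q = sym (ℚ.*-zeroˡ (evalℚ r q))
evalℚ-* (a ∷ p) r q
  rewrite evalℚ-+ (a ·ᴾ r) (0ℚ ∷ (p *ᴾ r)) q | evalℚ-· a r q | evalℚ-* p r q =
  solve 4 (λ a q u v → a :* v :+ (con 0ℚ :+ q :* (u :* v)) := (a :+ q :* u) :* v) refl
    a q (evalℚ p q) (evalℚ r q)

evalℚ-const : ∀ c q → evalℚ (constᴾ c) q ≡ c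
evalℚ-const c q = solve 2 (λ c q → c :+ q :* con 0ℚ := c) refl c q

evalℚ-X : ∀ q → evalℚ X q ≡ q
evalℚ-X q = solve 1 (λ q → con 0ℚ :+ q :* (con 1ℚ :+ q :* con 0ℚ) := q) refl q

evalℚ-+const : ∀ p c q → evalℚ (p +ᴾ constᴾ c) q ≡ evalℚ p q + c
evalℚ-+const p c q = trans (evalℚ-+ p (constᴾ c) q) (cong (evalℚ p q +_) (evalℚ-const c q))

-- `productᴾ` unfolds at its first factor, whereas the recursion for binomials splits off the last
-- one.
evalℚ-product-∷ʳ : ∀ ps p q →
  evalℚ (productᴾ (ps ∷ʳ p)) q ≡ evalℚ (productᴾ ps) q * evalℚ p q
evalℚ-product-∷ʳ [] p q = trans (evalℚ-* p (constᴾ 1ℚ) q) (ℚ.*-comm (evalℚ p q) _)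
evalℚ-product-∷ʳ (r ∷ ps) p q = begin-equality
  evalℚ (productᴾ (r ∷ ps ∷ʳ p)) q
    ≡⟨ evalℚ-* r (productᴾ (ps ∷ʳ p)) q ⟩
  evalℚ r q * evalℚ (productᴾ (ps ∷ʳ p)) q
    ≡⟨ cong (evalℚ r q *_) (evalℚ-product-∷ʳ ps p q) ⟩
  evalℚ r q * (evalℚ (productᴾ ps) q * evalℚ p q)
    ≡⟨ ℚ.*-assoc (evalℚ r q) (evalℚ (productᴾ ps) q) (evalℚ p q) ⟨
  evalℚ r q * evalℚ (productᴾ ps) q * evalℚ p q
    ≡⟨ cong (_* evalℚ p q) (evalℚ-* r (productᴾ ps) q) ⟨
  evalℚ (productᴾ (r ∷ ps)) q * evalℚ p q ∎
  where open ℚ.≤-Reasoning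

evalℚ-product-0 : ∀ ps q → Any (λ p → evalℚ p q ≡ 0ℚ) ps → evalℚ (productᴾ ps) q ≡ 0ℚ
evalℚ-product-0 (p ∷ ps) q (here p≡0)
  rewrite evalℚ-* p (productᴾ ps) q | p≡0 = ℚ.*-zeroˡ (evalℚ (productᴾ ps) q)
evalℚ-product-0 (p ∷ ps) q (there any)
  rewrite evalℚ-* p (productᴾ ps) q | evalℚ-product-0 ps q any = ℚ.*-zeroʳ (evalℚ p q)

evalℚ-sum-0 : ∀ ps q → All (λ p → evalℚ p q ≡ 0ℚ) ps → evalℚ (sumᴾ ps) q ≡ 0ℚ
evalℚ-sum-0 []       q []           = refl
evalℚ-sum-0 (p ∷ ps) q (p≡0 ∷ ps≡0) =
  trans (evalℚ-+ p (sumᴾ ps) q) (cong₂ _+_ p≡0 (evalℚ-sum-0 ps q ps≡0))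

-- Used with c = 1 and c = - 1, where c ^ length ps carries the sign of the product.
evalℚ-product-≥ : ∀ {δ} c ps q → 0ℚ ℚ.≤ δ → All (λ p → δ ℚ.≤ c * evalℚ p q) ps →
  δ ^ length ps ℚ.≤ c ^ length ps * evalℚ (productᴾ ps) q
evalℚ-product-≥ c [] q 0≤δ [] =
  ℚ.≤-reflexive (sym (trans (ℚ.*-identityˡ (evalℚ (constᴾ 1ℚ) q)) (evalℚ-const 1ℚ q)))
evalℚ-product-≥ {δ} c (p ∷ ps) q 0≤δ (δ≤p ∷ δ≤ps) = begin
  δ * δ ^ n
    ≤⟨ *-mono-≤-nonNeg 0≤δ (0≤^ n 0≤δ) δ≤p (evalℚ-product-≥ c ps q 0≤δ δ≤ps) ⟩
  (c * evalℚ p q) * (c ^ n * evalℚ (productᴾ ps) q)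
    ≡⟨ solve 4 (λ c u d v → (c :* u) :* (d :* v) := (c :* d) :* (u :* v)) refl
         c (evalℚ p q) (c ^ n) (evalℚ (productᴾ ps) q) ⟩
  (c * c ^ n) * (evalℚ p q * evalℚ (productᴾ ps) q)
    ≡⟨ cong ((c * c ^ n) *_) (evalℚ-* p (productᴾ ps) q) ⟨
  (c * c ^ n) * evalℚ (productᴾ (p ∷ ps)) q ∎
  where
  open ℚ.≤-Reasoning
  n = length ps

evalℚ-sum-≥0 : ∀ c ps q → All (λ p → 0ℚ ℚ.≤ c * evalℚ p q) ps →
  0ℚ ℚ.≤ c * evalℚ (sumᴾ ps) q
evalℚ-sum-≥0 c [] q [] = ℚ.≤-reflexive (sym (ℚ.*-zeroʳ c))
evalℚ-sum-≥0 c (p ∷ ps) q (0≤p ∷ 0≤ps) = begin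
  0ℚ                                       ≤⟨ ℚ.+-mono-≤ 0≤p (evalℚ-sum-≥0 c ps q 0≤ps) ⟩
  c * evalℚ p q + c * evalℚ (sumᴾ ps) q    ≡⟨ ℚ.*-distribˡ-+ c (evalℚ p q) (evalℚ (sumᴾ ps) q) ⟨
  c * (evalℚ p q + evalℚ (sumᴾ ps) q)      ≡⟨ cong (c *_) (evalℚ-+ p (sumᴾ ps) q) ⟨
  c * evalℚ (sumᴾ (p ∷ ps)) q              ∎
  where open ℚ.≤-Reasoning

-- Binomial polynomials.

-- The i-th factor in binom, with i counted from 0.
factor : Poly → ℕ → Poly
factor s i = s +ᴾ constᴾ (fromℕ (suc i))

evalℚ-factor : ∀ s i q → evalℚ (factor s i) q ≡ evalℚ s q + fromℕ (suc i)
evalℚ-factor s i q = evalℚ-+const s (fromℕ (suc i)) q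

evalℚ-factor-X : ∀ i q → evalℚ (factor X i) q ≡ q + fromℕ (suc i)
evalℚ-factor-X i q = trans (evalℚ-factor X i q) (cong (_+ fromℕ (suc i)) (evalℚ-X q))

X-1 : Poly
X-1 = X +ᴾ constᴾ (- 1ℚ)

-- The shift in `X-1` cancels the one in `factor`: these factors start at q, while those of
-- `factor X` start at q + 1.
evalℚ-factor-X-1 : ∀ i q → evalℚ (factor X-1 i) q ≡ q + fromℕ i
evalℚ-factor-X-1 i q = begin-equality
  evalℚ (factor X-1 i) q             ≡⟨ evalℚ-factor X-1 i q ⟩
  evalℚ X-1 q + fromℕ (suc i)        ≡⟨ cong₂ _+_ (evalℚ-+const X (- 1ℚ) q) (fromℕ-suc i) ⟩
  evalℚ X q - 1ℚ + (fromℕ i + 1ℚ)    ≡⟨ cong (λ r → r - 1ℚ + (fromℕ i + 1ℚ)) (evalℚ-X q) ⟩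
  q - 1ℚ + (fromℕ i + 1ℚ)            ≡⟨ solve 2 (λ q i → (q :+ :- con 1ℚ) :+ (i :+ con 1ℚ) := q :+ i)
                                          refl q (fromℕ i) ⟩
  q + fromℕ i                        ∎
  where open ℚ.≤-Reasoning

evalℚ-binom : ∀ a s q →
  evalℚ (binom a s) q ≡ 1/! a * evalℚ (productᴾ (applyUpTo (factor s) a)) q
evalℚ-binom a s q = evalℚ-· (1/! a) (productᴾ (applyUpTo (factor s) a)) q

evalℚ-binom-0 : ∀ {i} a s q → i < a → evalℚ (factor s i) q ≡ 0ℚ → evalℚ (binom a s) q ≡ 0ℚ
evalℚ-binom-0 a s q i<a root = trans (evalℚ-binom a s q)
  (trans (cong (1/! a *_)
            (evalℚ-product-0 (applyUpTo (factor s) a) q (Any.applyUpTo⁺ (factor s) root i<a)))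
         (ℚ.*-zeroʳ (1/! a)))

evalℚ-binom-zero : ∀ s q → evalℚ (binom 0 s) q ≡ 1ℚ
evalℚ-binom-zero s q = evalℚ-const 1ℚ q

-- Splits off the last factor, with (a + 1)! = (a + 1) a!. This exposes the common factor
-- `binom n X` of the summands j = 1 and j = 2.
evalℚ-binom-suc : ∀ a s q → evalℚ (binom (suc a) s) q ≡
  (ℤ.+ 1 / suc a) * (evalℚ (binom a s) q * evalℚ (factor s a) q)
evalℚ-binom-suc a s q = begin-equality
  evalℚ (binom (suc a) s) q
    ≡⟨ evalℚ-binom (suc a) s q ⟩
  1/! (suc a) * evalℚ (productᴾ (applyUpTo (factor s) (suc a))) q
    ≡⟨ cong₂ _*_ (1/!-suc a) (trans
         (cong (λ ps → evalℚ (productᴾ ps) q) (sym (applyUpTo-∷ʳ (factor s) a)))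
         (evalℚ-product-∷ʳ (applyUpTo (factor s) a) (factor s a) q)) ⟩
  (r * 1/! a) * (P * F)
    ≡⟨ solve 4 (λ r u v w → (r :* u) :* (v :* w) := r :* ((u :* v) :* w)) refl r (1/! a) P F ⟩
  r * ((1/! a * P) * F)
    ≡⟨ cong (λ t → r * (t * F)) (evalℚ-binom a s q) ⟨
  r * (evalℚ (binom a s) q * F) ∎
  where
  open ℚ.≤-Reasoning
  r = ℤ.+ 1 / suc a
  P = evalℚ (productᴾ (applyUpTo (factor s) a)) q
  F = evalℚ (factor s a) q

-- Each of the a factors contributes one δ to the bound and one c to the sign.
evalℚ-binom-≥ : ∀ {δ} a s c q → 0ℚ ℚ.≤ δ →
  (∀ {i} → i < a → δ ℚ.≤ c * evalℚ (factor s i) q) →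
  1/! a * δ ^ a ℚ.≤ c ^ a * evalℚ (binom a s) q
evalℚ-binom-≥ {δ} a s c q 0≤δ δ≤ = begin
  1/! a * δ ^ a
    ≤⟨ ℚ.*-monoˡ-≤-nonNeg (1/! a) {{ℚ.nonNegative (ℚ.<⇒≤ (1/!-pos a))}} product-≥ ⟩
  1/! a * (c ^ a * P)
    ≡⟨ solve 3 (λ r u v → r :* (u :* v) := u :* (r :* v)) refl (1/! a) (c ^ a) P ⟩
  c ^ a * (1/! a * P)
    ≡⟨ cong (c ^ a *_) (evalℚ-binom a s q) ⟨
  c ^ a * evalℚ (binom a s) q ∎
  where
  open ℚ.≤-Reasoning
  P = evalℚ (productᴾ (applyUpTo (factor s) a)) q
  product-≥ : δ ^ a ℚ.≤ c ^ a * P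
  product-≥ = subst (λ n → δ ^ n ℚ.≤ c ^ n * P) (length-applyUpTo (factor s) a)
    (evalℚ-product-≥ c (applyUpTo (factor s) a) q 0≤δ (All.applyUpTo⁺₁ (factor s) a δ≤))

0<1/!*^ : ∀ {δ} a → 0ℚ ℚ.< δ → 0ℚ ℚ.< 1/! a * δ ^ a
0<1/!*^ a 0<δ = 0<* (1/!-pos a) (0<^ a 0<δ)

0≤1/!*^ : ∀ {δ} a → 0ℚ ℚ.≤ δ → 0ℚ ℚ.≤ 1/! a * δ ^ a
0≤1/!*^ a 0≤δ = 0≤* (ℚ.<⇒≤ (1/!-pos a)) (0≤^ a 0≤δ)

-- The summands of `f`.

evalℚ-term : ∀ d j q →
  evalℚ (term d j) q ≡ evalℚ (binom (j ∸ 1) X-1) q * evalℚ (binom (d ∸ j) X) q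
evalℚ-term d j q = evalℚ-* (binom (j ∸ 1) X-1) (binom (d ∸ j) X) q

-- The two binomials have i and m - i factors, so the sign is c ^ m whatever i is; hence different
-- summands cannot cancel.
evalℚ-term-≥0 : ∀ m i c q → i ≤ m →
  (∀ {k} → k < i → 0ℚ ℚ.≤ c * (q + fromℕ k)) →
  (∀ {k} → k < m ∸ i → 0ℚ ℚ.≤ c * (q + fromℕ (suc k))) →
  0ℚ ℚ.≤ c ^ m * evalℚ (term (suc m) (suc i)) q
evalℚ-term-≥0 m i c q i≤m low high = begin
  0ℚ
    -- Only signs are wanted, so the lower bound for each factor is taken with δ = 0.
    ≤⟨ 0≤* (ℚ.≤-trans (0≤1/!*^ i ℚ.≤-refl) (evalℚ-binom-≥ i X-1 c q ℚ.≤-refl low′))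
           (ℚ.≤-trans (0≤1/!*^ (m ∸ i) ℚ.≤-refl) (evalℚ-binom-≥ (m ∸ i) X c q ℚ.≤-refl high′)) ⟩
  (c ^ i * A) * (c ^ (m ∸ i) * B)
    ≡⟨ solve 4 (λ c u d v → (c :* u) :* (d :* v) := (c :* d) :* (u :* v)) refl
         (c ^ i) A (c ^ (m ∸ i)) B ⟩
  (c ^ i * c ^ (m ∸ i)) * (A * B)
    ≡⟨ cong₂ _*_ (trans (sym (^-homo-* c i (m ∸ i))) (cong (c ^_) (ℕ.m+[n∸m]≡n i≤m)))
                 (sym (evalℚ-term (suc m) (suc i) q)) ⟩
  c ^ m * evalℚ (term (suc m) (suc i)) q ∎
  where
  open ℚ.≤-Reasoning
  A = evalℚ (binom i X-1) q
  B = evalℚ (binom (m ∸ i) X) q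
  low′ : ∀ {k} → k < i → 0ℚ ℚ.≤ c * evalℚ (factor X-1 k) q
  low′ {k} k<i = subst (λ r → 0ℚ ℚ.≤ c * r) (sym (evalℚ-factor-X-1 k q)) (low k<i)
  high′ : ∀ {k} → k < m ∸ i → 0ℚ ℚ.≤ c * evalℚ (factor X k) q
  high′ {k} k< = subst (λ r → 0ℚ ℚ.≤ c * r) (sym (evalℚ-factor-X k q)) (high k<)

evalℚ-f-root : ∀ {d p k} → k < d ∸ p → evalℚ (f d p) (- fromℕ (suc k)) ≡ 0ℚ
evalℚ-f-root {d} {p} {k} k<d∸p =
  evalℚ-sum-0 (applyUpTo (λ i → term d (suc i)) p) q
    (All.applyUpTo⁺₁ (λ i → term d (suc i)) p λ {i} i<p →
  trans (evalℚ-term d (suc i) q)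
    (trans (cong (evalℚ (binom i X-1) q *_)
              -- As i + 1 ≤ p, the second binomial has at least d - p factors, and the one of index
              -- k, which is q + (k + 1), is among them.
              (evalℚ-binom-0 (d ∸ suc i) X q (ℕ.≤-trans k<d∸p (ℕ.∸-monoʳ-≤ d i<p))
                (trans (evalℚ-factor-X k q) (ℚ.+-inverseˡ (fromℕ (suc k))))))
           (ℚ.*-zeroʳ (evalℚ (binom i X-1) q))))
  where q = - fromℕ (suc k)

evalℚ-term-1 : ∀ m q → evalℚ (term (suc m) 1) q ≡ evalℚ (binom m X) q
evalℚ-term-1 m q = trans (evalℚ-term (suc m) 1 q)
  (trans (cong (_* evalℚ (binom m X) q) (evalℚ-binom-zero X-1 q)) (ℚ.*-identityˡ _))

evalℚ-term-2 : ∀ n q → evalℚ (term (2 ℕ.+ n) 2) q ≡ q * evalℚ (binom n X) q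
evalℚ-term-2 n q = trans (evalℚ-term (2 ℕ.+ n) 2 q) (cong (_* evalℚ (binom n X) q) binom-1)
  where
  binom-1 : evalℚ (binom 1 X-1) q ≡ q
  binom-1 = trans (evalℚ-binom-suc 0 X-1 q)
    (trans (cong (1ℚ *_) (cong₂ _*_ (evalℚ-binom-zero X-1 q) (evalℚ-factor-X-1 0 q)))
      (solve 1 (λ q → con 1ℚ :* (con 1ℚ :* (q :+ con 0ℚ)) := q) refl q))

-- Bounds for `f` on the right and on the left.

≤-+-nonNeg : ∀ {δ} c u v → δ ℚ.≤ c * u → 0ℚ ℚ.≤ c * v → δ ℚ.≤ c * (u + v)
≤-+-nonNeg {δ} c u v δ≤cu 0≤cv = begin
  δ              ≡⟨ ℚ.+-identityʳ δ ⟨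
  δ + 0ℚ         ≤⟨ ℚ.+-mono-≤ δ≤cu 0≤cv ⟩
  c * u + c * v  ≡⟨ ℚ.*-distribˡ-+ c u v ⟨
  c * (u + v)    ∎
  where open ℚ.≤-Reasoning

-- The summand j = 1 has only factors that are at least 1; the others are nonnegative. On the left
-- `1ℚ ^ m` is the bound δ ^ m with δ = 1; in the proof it is also the sign c ^ m.
f-bound-right : ∀ {m p q} → p ≤ m → 0ℚ ℚ.≤ q →
  1/! m * 1ℚ ^ m ℚ.≤ ∣ evalℚ (f (suc m) (suc p)) q ∣
f-bound-right {m} {p} {q} p≤m 0≤q = ≤-*-unit⇒≤-∣∣ (1ℚ ^ m) (evalℚ (f (suc m) (suc p)) q) (∣^∣≡1 m refl)
  (subst (λ r → 1/! m * 1ℚ ^ m ℚ.≤ 1ℚ ^ m * r) (sym (evalℚ-+ (term (suc m) 1) (sumᴾ rest) q))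
    (≤-+-nonNeg (1ℚ ^ m) (evalℚ (term (suc m) 1) q) (evalℚ (sumᴾ rest) q) head-≥
      (evalℚ-sum-≥0 (1ℚ ^ m) rest q (All.applyUpTo⁺₁ (λ i → term (suc m) (2 ℕ.+ i)) p rest-≥0))))
  where
  rest = applyUpTo (λ i → term (suc m) (2 ℕ.+ i)) p
  0≤q+ : ∀ k → 0ℚ ℚ.≤ 1ℚ * (q + fromℕ k)
  0≤q+ k = subst (0ℚ ℚ.≤_) (sym (ℚ.*-identityˡ _))
    (ℚ.+-mono-≤ 0≤q (fromℕ-mono-≤ (z≤n {k})))
  head-≥ : 1/! m * 1ℚ ^ m ℚ.≤ 1ℚ ^ m * evalℚ (term (suc m) 1) q
  head-≥ = subst (λ r → 1/! m * 1ℚ ^ m ℚ.≤ 1ℚ ^ m * r) (sym (evalℚ-term-1 m q))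
    (evalℚ-binom-≥ m X 1ℚ q (ℚ.nonNegative⁻¹ 1ℚ) λ {k} _ →
      subst (1ℚ ℚ.≤_) (sym (trans (ℚ.*-identityˡ _) (evalℚ-factor-X k q)))
        (ℚ.+-mono-≤ 0≤q (fromℕ-mono-≤ (s≤s (z≤n {k})))))
  rest-≥0 : ∀ {i} → i < p → 0ℚ ℚ.≤ 1ℚ ^ m * evalℚ (term (suc m) (2 ℕ.+ i)) q
  rest-≥0 i<p = evalℚ-term-≥0 m (suc _) 1ℚ q (ℕ.≤-trans i<p p≤m) (λ {k} _ → 0≤q+ k) (λ {k} _ → 0≤q+ (suc k))

-- Of the constant, `1/! n * ε ^ n` bounds the common factor B of the first two summands and the
-- last ε bounds the cofactor Q.
f-bound-left : ∀ {n p q ε} → 1 ≤ n → p < n → 0ℚ ℚ.< ε → q + ε ℚ.≤ - fromℕ n →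
  (1/! n * ε ^ n) * ε ℚ.≤ ∣ evalℚ (f (2 ℕ.+ n) (2 ℕ.+ p)) q ∣
f-bound-left {n} {p} {q} {ε} 1≤n p<n 0<ε q+ε≤-n = ≤-*-unit⇒≤-∣∣ (c ^ suc n) (evalℚ (f d (2 ℕ.+ p)) q) (∣^∣≡1 (suc n) refl)
  (subst (λ r → δ ℚ.≤ c ^ suc n * r) (sym split)
    (≤-+-nonNeg (c ^ suc n) (T₁ + T₂) (evalℚ (sumᴾ rest) q) head-≥
      (evalℚ-sum-≥0 (c ^ suc n) rest q (All.applyUpTo⁺₁ (λ i → term (2 ℕ.+ n) (3 ℕ.+ i)) p rest-≥0))))
  where
  open ℚ.≤-Reasoning
  c = - 1ℚ
  δ = (1/! n * ε ^ n) * ε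
  d = 2 ℕ.+ n
  rest = applyUpTo (λ i → term d (3 ℕ.+ i)) p
  T₁ = evalℚ (term d 1) q
  T₂ = evalℚ (term d 2) q
  B = evalℚ (binom n X) q
  r = ℤ.+ 1 / suc n

  0≤ε : 0ℚ ℚ.≤ ε
  0≤ε = ℚ.<⇒≤ 0<ε

  split : evalℚ (f d (2 ℕ.+ p)) q ≡ (T₁ + T₂) + evalℚ (sumᴾ rest) q
  split = trans (evalℚ-+ (term d 1) (term d 2 +ᴾ sumᴾ rest) q)
    (trans (cong (T₁ +_) (evalℚ-+ (term d 2) (sumᴾ rest) q))
           (sym (ℚ.+-assoc T₁ T₂ (evalℚ (sumᴾ rest) q))))

  ε≤-[q+k] : ∀ k → k ≤ n → ε ℚ.≤ c * (q + fromℕ k)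
  ε≤-[q+k] k k≤n = begin
    ε
      ≡⟨ solve 2 (λ q e → e := (q :+ e) :+ :- q) refl q ε ⟩
    (q + ε) - q
      ≤⟨ ℚ.+-monoˡ-≤ (- q) (ℚ.≤-trans q+ε≤-n (ℚ.neg-antimono-≤ (fromℕ-mono-≤ k≤n))) ⟩
    - fromℕ k - q
      ≡⟨ solve 2 (λ q k → :- k :+ :- q := con (- 1ℚ) :* (q :+ k)) refl q (fromℕ k) ⟩
    c * (q + fromℕ k) ∎

  -- The last factor q + n + 1 of the summand j = 1 is out of reach of `ε≤-[q+k]`. Its weight r = 1
  -- / (n + 1) turns it into 1 + r q, which joins the q of the summand j = 2.
  Q = q + 1ℚ + r * q

  T₁+T₂ : T₁ + T₂ ≡ B * Q
  T₁+T₂ = begin-equality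
    T₁ + T₂
      ≡⟨ cong₂ _+_ (trans (evalℚ-term-1 (suc n) q) (evalℚ-binom-suc n X q)) (evalℚ-term-2 n q) ⟩
    r * (B * evalℚ (factor X n) q) + q * B
      ≡⟨ cong (λ t → r * (B * t) + q * B) (evalℚ-factor-X n q) ⟩
    r * (B * (q + fromℕ (suc n))) + q * B
      ≡⟨ solve 4 (λ r b q s → r :* (b :* (q :+ s)) :+ q :* b := b :* (q :+ r :* s :+ r :* q))
           refl r B q (fromℕ (suc n)) ⟩
    B * (q + r * fromℕ (suc n) + r * q)
      ≡⟨ cong (λ t → B * (q + t + r * q)) (1/n*n≡1 (suc n)) ⟩
    B * Q ∎

  ε≤-Q : ε ℚ.≤ c * Q
  ε≤-Q = begin
    ε
      ≡⟨ ℚ.+-identityʳ ε ⟨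
    ε + 0ℚ
      -- Q is (q + 1) + r q: the first part is at most - ε because 1 ≤ n, the second is at most 0.
      ≤⟨ ℚ.+-mono-≤ (ε≤-[q+k] 1 1≤n)
           (0≤* (ℚ.<⇒≤ (1/n-pos (suc n))) (ℚ.≤-trans 0≤ε (ε≤-[q+k] 0 z≤n))) ⟩
    c * (q + 1ℚ) + r * (c * (q + 0ℚ))
      ≡⟨ solve 2 (λ q r → con (- 1ℚ) :* (q :+ con 1ℚ) :+ r :* (con (- 1ℚ) :* (q :+ con 0ℚ)) :=
                          con (- 1ℚ) :* (q :+ con 1ℚ :+ r :* q)) refl q r ⟩
    c * Q ∎

  head-≥ : δ ℚ.≤ c ^ suc n * (T₁ + T₂)
  head-≥ = begin
    δ
      ≤⟨ *-mono-≤-nonNeg (0≤1/!*^ n 0≤ε) 0≤ε (evalℚ-binom-≥ n X c q 0≤ε λ {k} k<n →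
             subst (λ t → ε ℚ.≤ c * t) (sym (evalℚ-factor-X k q)) (ε≤-[q+k] (suc k) k<n))
           ε≤-Q ⟩
    (c ^ n * B) * (c * Q)
      ≡⟨ solve 4 (λ d b c q → (d :* b) :* (c :* q) := (c :* d) :* (b :* q)) refl (c ^ n) B c Q ⟩
    c ^ suc n * (B * Q)
      ≡⟨ cong (c ^ suc n *_) T₁+T₂ ⟨
    c ^ suc n * (T₁ + T₂) ∎

  rest-≥0 : ∀ {i} → i < p → 0ℚ ℚ.≤ c ^ suc n * evalℚ (term d (3 ℕ.+ i)) q
  -- With j = i + 3, the factors q + k have k ≤ j - 2 in the first binomial and k ≤ d - j in the
  -- second; both limits are below n, so every factor is negative.
  rest-≥0 {i} i<p = evalℚ-term-≥0 (suc n) (2 ℕ.+ i) c q (ℕ.≤-trans 2+i≤n (ℕ.n≤1+n n))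
    (λ {k} k<2+i → ℚ.≤-trans 0≤ε (ε≤-[q+k] k (ℕ.≤-trans (ℕ.<⇒≤ k<2+i) 2+i≤n)))
    (λ {k} k< → ℚ.≤-trans 0≤ε (ε≤-[q+k] (suc k) (ℕ.≤-trans k< (ℕ.m∸n≤m n (suc i)))))
    where
    2+i≤n : 2 ℕ.+ i ≤ n
    2+i≤n = ℕ.≤-trans (s≤s i<p) p<n

-- From rational bounds to real zeros.

zeros-lower-bound : ∀ {g a x} →
  (∀ ε → 0ℚ ℚ.< ε → ∃[ δ ] (0ℚ ℚ.< δ × (∀ {q} → q + ε ℚ.≤ a → δ ℚ.≤ ∣ evalℚ g q ∣))) →
  V g (fromℝ x) → fromℚ a ≤ᴿ x
zeros-lower-bound {g} {a} {x} away gx≃0 ε 0<ε =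
  let δ , 0<δ , away-δ = away ε 0<ε
      N , small = V⇒Null {g} {x} gx≃0 δ 0<δ
  -- At a late index, x + ε < a would force a value of size at least δ, though the values tend to 0.
  -- Since `_≤ᴿ_` fixes ε first, δ may depend on ε.
  in N , λ n N≤n → ℚ.≮⇒≥ λ x+ε<a →
    ℚ.<-irrefl refl (ℚ.<-≤-trans (small n N≤n) (away-δ (ℚ.<⇒≤ x+ε<a)))

-- Carries the bound slightly to the left of a: if q lies within ε below a, the value at a is less
-- than ½ δ + ½ δ in size, against the bound at a itself.
avoids-near-and-right : ∀ g {a q ε} δ → 0ℚ ℚ.< δ →
  (∀ {r} → a ℚ.≤ r → δ ℚ.≤ ∣ evalℚ g r ∣) →
  (∣ q - a ∣ ℚ.< ε → ∣ evalℚ g q - evalℚ g a ∣ ℚ.< ½ * δ) →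
  ∣ evalℚ g q ∣ ℚ.< ½ * δ → a ℚ.≮ q + ε
avoids-near-and-right g {a} {q} {ε} δ 0<δ away near small a<q+ε with ℚ.≤-total a q
... | inj₁ a≤q = ℚ.<-irrefl refl (ℚ.<-≤-trans small-q (away a≤q))
  where
  open ℚ.≤-Reasoning
  small-q : ∣ evalℚ g q ∣ ℚ.< δ
  small-q = begin-strict
    ∣ evalℚ g q ∣  <⟨ small ⟩
    ½ * δ          ≡⟨ ℚ.+-identityʳ (½ * δ) ⟨
    ½ * δ + 0ℚ     <⟨ ℚ.+-monoʳ-< (½ * δ) (half-pos 0<δ) ⟩
    ½ * δ + ½ * δ  ≡⟨ halves δ ⟩
    δ              ∎
... | inj₂ q≤a = ℚ.<-irrefl refl (ℚ.<-≤-trans small-a (away ℚ.≤-refl))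
  where
  open ℚ.≤-Reasoning
  u = evalℚ g q
  v = evalℚ g a
  0≤a-q : 0ℚ ℚ.≤ a - q
  0≤a-q = subst (ℚ._≤ a - q) (ℚ.+-inverseʳ q) (ℚ.+-monoˡ-≤ (- q) q≤a)
  close : ∣ q - a ∣ ℚ.< ε
  close = begin-strict
    ∣ q - a ∣      ≡⟨ ℚ.∣-p∣≡∣p∣ (q - a) ⟨
    ∣ - (q - a) ∣  ≡⟨ cong ∣_∣ (solve 2 (λ q a → :- (q :+ :- a) := a :+ :- q) refl q a) ⟩
    ∣ a - q ∣      ≡⟨ ℚ.0≤p⇒∣p∣≡p 0≤a-q ⟩
    a - q          <⟨ ℚ.+-monoˡ-< (- q) a<q+ε ⟩
    q + ε - q      ≡⟨ solve 2 (λ q e → q :+ e :+ :- q := e) refl q ε ⟩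
    ε              ∎
  small-a : ∣ v ∣ ℚ.< δ
  small-a = begin-strict
    ∣ v ∣              ≡⟨ cong ∣_∣ (solve 2 (λ u v → v := u :+ :- (u :+ :- v)) refl u v) ⟩
    ∣ u - (u - v) ∣    ≤⟨ ℚ.∣p-q∣≤∣p∣+∣q∣ u (u - v) ⟩
    ∣ u ∣ + ∣ u - v ∣  <⟨ ℚ.+-mono-< small (near close) ⟩
    ½ * δ + ½ * δ      ≡⟨ halves δ ⟩
    δ                  ∎

-- The strict order `_<ᴿ_` asks for a fixed gap below a; the radius of continuity at a for the
-- tolerance ½ δ provides it.
zeros-upper-bound : ∀ {g a x} δ → 0ℚ ℚ.< δ → (∀ {q} → a ℚ.≤ q → δ ℚ.≤ ∣ evalℚ g q ∣) →
  V g (fromℝ x) → x <ᴿ fromℚ a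
zeros-upper-bound {g} {a} {x} δ 0<δ away gx≃0 =
  let ε , 0<ε , N , near = evalℚ-near g x a (½ * δ) (half-pos 0<δ)
      M , small = V⇒Null {g} {x} gx≃0 (½ * δ) (half-pos 0<δ)
  in ε , 0<ε , N ℕ.⊔ M , λ n ≤n → ℚ.≮⇒≥
       (avoids-near-and-right g δ 0<δ away
         (near n (ℕ.m⊔n≤o⇒m≤o N M ≤n)) (small n (ℕ.m⊔n≤o⇒n≤o N M ≤n)))

theorem2p5 : (d p : ℕ) → 2 ≤ p → p < d →
    (negatives (d ∸ p) ⊆ V (f d p) ∩ℝ) ×
    (V (f d p) ∩ℝ ⊆ [ -ᴿ fromℚ (fromℕ (d ∸ 2)) , 0ᴿ ⟩)
-- Thus m = d - 1, n = d - 2 and p = p′ + 2; from p′ < n also 1 ≤ n.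
theorem2p5 d@(suc m@(suc n)) p@(suc (suc p′)) (s≤s (s≤s _)) (s≤s (s≤s p′<n)) =
    (λ { {x} (suc k , 1≤k , k≤ , x≃-k) →
         -- `k≤` serves as k < d - p, since factors are indexed from 0 and the root is - (k + 1).
         root⇒V {f d p} { - fromℕ (suc k) } {x} (evalℚ-f-root {d} {p} k≤) x≃-k })
  , (λ {x} fx≃0 →
        zeros-lower-bound {f d p} { - fromℕ n } {x}
          (λ ε 0<ε → _ , 0<* (0<1/!*^ n 0<ε) 0<ε ,
            f-bound-left {n} {p′} (ℕ.≤-trans (s≤s z≤n) p′<n) p′<n 0<ε) fx≃0
      , zeros-upper-bound {f d p} {0ℚ} {x}
          (1/! m * 1ℚ ^ m) (0<1/!*^ m (ℚ.positive⁻¹ 1ℚ))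
          (f-bound-right {m} {suc p′} (ℕ.≤-trans p′<n (ℕ.n≤1+n n))) fx≃0)
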